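{- Let $X$ be a real topological vector space whose topology is given by a pseudometric (or metric) $\sigma$ that is equivalent to a paranorm on $X$. Let $c_0\in X$, $r>0$, and let $B=B_r^X(c_0)=\{x\in X:\ \sigma(x,c_0)\le r\}$, equipped with the partial operations $(a,b)\mapsto \alpha a\oplus\beta b$ (for $\alpha,\beta\in\mathbb{R}$) and the partial scalar multiplication described in the context. Then for all $a,b,d\in B$ and all $\alpha,\beta\in\mathbb{R}$: \begin{enumerate} \item $a\oplus b \stackrel{s}{=} b\oplus a$; \item $a\oplus(b\oplus d)\stackrel{\omega}{=}(a\oplus b)\oplus d$; \item $\alpha(\beta a)\stackrel{\omega}{=}(\alpha\beta)a$; \item $\alpha a\oplus\beta a\stackrel{s}{=}(\alpha+\beta)a$; \item $a\oplus 0\stackrel{s}{=}0\oplus a$, where $0$ is the zero vector of $X$; \item if $a\oplus b=0=a\oplus d$ (in particular, both are defined), then $b=d$. \end{enumerate}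
   Context: Pseudometric: a function $\sigma:X^2\to\mathbb{R}_+$ with $\sigma(a,a)=0$ for all $a$, which is symmetric ($\sigma(a,b)=\sigma(b,a)$), satisfies the triangle inequality $\sigma(a,b)\le\sigma(a,c)+\sigma(c,b)$, and satisfies ($\sigma(a,b)=0\Rightarrow a=b$). The vector space operations of $X$ are jointly continuous with respect to $\sigma$. Paranorm: a function $p:X\to\mathbb{R}_+$ with $p(0)=0$, $p(x)\ge 0$, $p(-x)=p(x)$, $p(x+b)\le p(x)+p(b)$, and for which scalar multiplication is continuous. A paranorm gives the distance $(a,b)\mapsto p(a-b)$; "$\sigma$ is equivalent to a paranorm" means that $\sigma$ and such a distance determine the same topology. Partial operations on $B=B_r^X(c_0)$: for $a,b\in B$ and $\alpha,\beta\in\mathbb{R}$, $\alpha a\oplus\beta b$ is defined if and only if the vector $\alpha a+\beta b$ (computed in $X$) lies in $B$, and in that case $\alpha a\oplus\beta b:=\alpha a+\beta b$; otherwise it is undefined. This is one partial operation of $(a,b)$ for each pair $(\alpha,\beta)$; the vectors $\alpha a$ and $\beta b$ are not individually required to lie in $B$. $a\oplus b$ means the case $\alpha=\beta=1$. The scalar multiple $\alpha a$, as a term evaluated in $B$, is defined if and only if the vector $\alpha a\in X$ lies in $B$, and then it equals that vector. A compound term is defined only if all its subterms are defined in $B$ (for instance $a\oplus(b\oplus d)$ requires $b\oplus d$ to be defined, $\alpha(\beta a)$ requires $\beta a\in B$, and a term with the constant $0$ as an argument of $\oplus$ requires $0\in B$); here $\alpha a\oplus\beta b$ is treated as a single application of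 the operation indexed by $(\alpha,\beta)$ to $(a,b)$. Equalities of partial terms: $s\stackrel{\omega}{=}t$ means that if both $s$ and $t$ are defined then they are equal. $s\stackrel{s}{=}t$ means that if either of $s,t$ is defined, then so is the other and the two are equal. -}

module Defs where

open import Algebra.Bundles using (CommutativeRing)
open import Algebra.Module.Bundles using (LeftModule)
open import Algebra.Structures using (IsCommutativeRing)
open import Data.Nat.Base as ℕ using (ℕ)
import Data.Nat.Properties as ℕ
open import Data.Product.Base using (Σ; Σ-syntax; ∃-syntax; _×_; _,_; proj₁; proj₂)
open import Data.Rational.Base as ℚ using (ℚ; 0ℚ; 1ℚ; ½; _+_; _*_; -_; _-_; ∣_∣)
import Data.Rational.Properties as ℚ
open import Data.Rational.Solver using (module +-*-Solver)
open import Data.Sum.Base using (inj₁; inj₂)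
open import Data.Unit.Base using (⊤)
open import Function.Base using (_∘_)
open import Function.Bundles using (_⇔_)
open import Function.Metric.Core using (DistanceFunction)
open import Function.Metric.Structures using (IsGeneralMetric)
open import Level using (0ℓ; _⊔_)
open import Relation.Binary.PropositionalEquality
  using (_≡_; refl; sym; trans; cong; subst)
open import Relation.Binary.Structures using (IsEquivalence; IsPartialOrder)
open import Relation.Unary using (Pred)

-- Real numbers: Cauchy sequences of rationals, with the order and the
-- ring operations induced from ℚ and the equality "the difference tends
-- to zero".

Eventually : Pred ℕ 0ℓ → Set
Eventually P = ∃[ N ] (∀ n → N ℕ.≤ n → P n)

record ℝ : Set where
  constructor mkℝ
  field
    seq    : ℕ → ℚ
    cauchy : ∀ ε → 0ℚ ℚ.< ε →
             ∃[ N ] (∀ m n → N ℕ.≤ m → N ℕ.≤ n → ∣ seq m - seq n ∣ ℚ.< ε)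

open ℝ public

infix 4 _≈ℝ_ _≤ℝ_ _<ℝ_

_≈ℝ_ : ℝ → ℝ → Set
x ≈ℝ y = ∀ ε → 0ℚ ℚ.< ε → Eventually (λ n → ∣ seq x n - seq y n ∣ ℚ.< ε)

_≤ℝ_ : ℝ → ℝ → Set
x ≤ℝ y = ∀ ε → 0ℚ ℚ.< ε → Eventually (λ n → seq x n ℚ.< seq y n + ε)

_<ℝ_ : ℝ → ℝ → Set
x <ℝ y = ∃[ ε ] 0ℚ ℚ.< ε × Eventually (λ n → seq x n + ε ℚ.< seq y n)

private

  both : ∀ {P Q R : Pred ℕ 0ℓ} → Eventually P → Eventually Q →
         (∀ n → P n → Q n → R n) → Eventually R
  both (M , p) (N , q) f = M ℕ.⊔ N , λ n le →
    f n (p n (ℕ.≤-trans (ℕ.m≤m⊔n M N) le)) (q n (ℕ.≤-trans (ℕ.m≤n⊔m M N) le))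

  half>0 : ∀ {ε} → 0ℚ ℚ.< ε → 0ℚ ℚ.< ½ * ε
  half>0 {ε} ε>0 = subst (ℚ._< ½ * ε) (ℚ.*-zeroʳ ½) (ℚ.*-monoʳ-<-pos ½ ε>0)

  halves : ∀ ε → ½ * ε + ½ * ε ≡ ε
  halves ε = trans (sym (ℚ.*-distribʳ-+ ε ½ ½)) (ℚ.*-identityˡ ε)

  -‿involutive : ∀ p → - - p ≡ p
  -‿involutive = solve 1 (λ p → :- :- p := p) refl
    where open +-*-Solver

  p≤∣p∣ : ∀ p → p ℚ.≤ ∣ p ∣
  p≤∣p∣ p with ℚ.∣p∣≡p∨∣p∣≡-p p
  ... | inj₁ eq = ℚ.≤-reflexive (sym eq)
  ... | inj₂ eq = ℚ.≤-trans p≤0 (ℚ.0≤∣p∣ p)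
    where
    p≤0 : p ℚ.≤ 0ℚ
    p≤0 = subst (ℚ._≤ 0ℚ) (trans (cong (λ t → - t) eq) (-‿involutive p))
            (ℚ.neg-antimono-≤ (ℚ.0≤∣p∣ p))

  -[p-q]≡q-p : ∀ p q → - (p - q) ≡ q - p
  -[p-q]≡q-p = solve 2 (λ p q → :- (p :- q) := q :- p) refl
    where open +-*-Solver

  ∣p-q∣≡∣q-p∣ : ∀ p q → ∣ p - q ∣ ≡ ∣ q - p ∣
  ∣p-q∣≡∣q-p∣ p q = trans (sym (ℚ.∣-p∣≡∣p∣ (p - q))) (cong ∣_∣ (-[p-q]≡q-p p q))

  ∣p-p∣≡0 : ∀ p → ∣ p - p ∣ ≡ 0ℚ
  ∣p-p∣≡0 p = cong ∣_∣ (ℚ.+-inverseʳ p)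

  p≡q+[p-q] : ∀ p q → q + (p - q) ≡ p
  p≡q+[p-q] = solve 2 (λ p q → q :+ (p :- q) := p) refl
    where open +-*-Solver

  near⇒< : ∀ {p q ε} → ∣ p - q ∣ ℚ.< ε → p ℚ.< q + ε
  near⇒< {p} {q} lt = subst (ℚ._< q + _) (p≡q+[p-q] p q)
    (ℚ.+-monoʳ-< q (ℚ.≤-<-trans (p≤∣p∣ (p - q)) lt))

  <⇒-< : ∀ {p q ε} → p ℚ.< q + ε → p - q ℚ.< ε
  <⇒-< {p} {q} {ε} lt = subst (p - q ℚ.<_) (eq q ε) (ℚ.+-monoˡ-< (- q) lt)
    where
    open +-*-Solver
    eq : ∀ q ε → (q + ε) - q ≡ ε
    eq = solve 2 (λ q ε → (q :+ ε) :- q := ε) refl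

  <∧>⇒near : ∀ {p q ε} → p ℚ.< q + ε → q ℚ.< p + ε → ∣ p - q ∣ ℚ.< ε
  <∧>⇒near {p} {q} {ε} l r with ℚ.∣p∣≡p∨∣p∣≡-p (p - q)
  ... | inj₁ eq = subst (ℚ._< ε) (sym eq) (<⇒-< l)
  ... | inj₂ eq = subst (ℚ._< ε) (sym (trans eq (-[p-q]≡q-p p q))) (<⇒-< r)

  <-trans-½ : ∀ {p q s} ε → p ℚ.< q + ½ * ε → q ℚ.< s + ½ * ε → p ℚ.< s + ε
  <-trans-½ {p} {q} {s} ε l r = ℚ.<-trans l (subst (q + ½ * ε ℚ.<_)
    (trans (ℚ.+-assoc s (½ * ε) (½ * ε)) (cong (s +_) (halves ε)))
    (ℚ.+-monoˡ-< (½ * ε) r))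

  ≡⇒≈ : ∀ {x y} → (∀ n → seq x n ≡ seq y n) → x ≈ℝ y
  ≡⇒≈ {x} {y} eq ε ε>0 = 0 , λ n _ → subst (ℚ._< ε)
    (sym (trans (cong (λ t → ∣ seq x n - t ∣) (sym (eq n))) (∣p-p∣≡0 (seq x n)))) ε>0

  ≈⇒≤ : ∀ {x y} → x ≈ℝ y → x ≤ℝ y
  ≈⇒≤ {x} {y} eq ε ε>0 with eq ε ε>0
  ... | N , p = N , λ n le → near⇒< {seq x n} {seq y n} (p n le)

  ≈-sym : ∀ {x y} → x ≈ℝ y → y ≈ℝ x
  ≈-sym {x} {y} eq ε ε>0 with eq ε ε>0
  ... | N , p = N , λ n le → subst (ℚ._< ε) (∣p-q∣≡∣q-p∣ (seq x n) (seq y n)) (p n le)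

  ≤-antisym : ∀ {x y} → x ≤ℝ y → y ≤ℝ x → x ≈ℝ y
  ≤-antisym {x} {y} l r ε ε>0 =
    both (l ε ε>0) (r ε ε>0) (λ n → <∧>⇒near {seq x n} {seq y n})

  ≤-trans : ∀ {x y z} → x ≤ℝ y → y ≤ℝ z → x ≤ℝ z
  ≤-trans {x} {y} {z} l r ε ε>0 =
    both (l (½ * ε) (half>0 ε>0)) (r (½ * ε) (half>0 ε>0))
      (λ n → <-trans-½ {seq x n} {seq y n} {seq z n} ε)

≈ℝ-isEquivalence : IsEquivalence _≈ℝ_
≈ℝ-isEquivalence = record
  { refl  = λ {x} → ≡⇒≈ {x} {x} (λ _ → refl)
  ; sym   = λ {x} {y} → ≈-sym {x} {y}
  ; trans = λ {x} {y} {z} l r → ≤-antisym {x} {z}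
      (≤-trans {x} {y} {z} (≈⇒≤ {x} {y} l) (≈⇒≤ {y} {z} r))
      (≤-trans {z} {y} {x} (≈⇒≤ {z} {y} (≈-sym {y} {z} r)) (≈⇒≤ {y} {x} (≈-sym {x} {y} l)))
  }

≤ℝ-isPartialOrder : IsPartialOrder _≈ℝ_ _≤ℝ_
≤ℝ-isPartialOrder = record
  { isPreorder = record
    { isEquivalence = ≈ℝ-isEquivalence
    ; reflexive     = λ {x} {y} → ≈⇒≤ {x} {y}
    ; trans         = λ {x} {y} {z} → ≤-trans {x} {y} {z}
    }
  ; antisym = λ {x} {y} → ≤-antisym {x} {y}
  }

private

  -- A 1-Lipschitz function on ℚ extends to ℝ.
  Lipschitz : (ℚ → ℚ) → Set
  Lipschitz f = ∀ p q → ∣ f p - f q ∣ ℚ.≤ ∣ p - q ∣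

  lift₁ : ∀ f → Lipschitz f → ℝ → ℝ
  lift₁ f lip x = mkℝ (f ∘ seq x) λ ε ε>0 → let N , c = cauchy x ε ε>0 in
    N , λ m n M≤m N≤n → ℚ.≤-<-trans (lip (seq x m) (seq x n)) (c m n M≤m N≤n)

  lift₁-cong : ∀ f (lip : Lipschitz f) {x y} → x ≈ℝ y → lift₁ f lip x ≈ℝ lift₁ f lip y
  lift₁-cong f lip {x} {y} eq ε ε>0 = let N , c = eq ε ε>0 in
    N , λ n N≤n → ℚ.≤-<-trans (lip (seq x n) (seq y n)) (c n N≤n)

  -- A binary function on ℚ that is uniformly continuous on bounded sets
  -- extends to ℝ.
  LocallyUC : (ℚ → ℚ → ℚ) → Set
  LocallyUC f = ∀ M → 0ℚ ℚ.< M → ∀ ε → 0ℚ ℚ.< ε → ∃[ δ ] 0ℚ ℚ.< δ ×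
    (∀ p q p′ q′ → ∣ p ∣ ℚ.≤ M → ∣ q′ ∣ ℚ.≤ M →
     ∣ p - p′ ∣ ℚ.< δ → ∣ q - q′ ∣ ℚ.< δ → ∣ f p q - f p′ q′ ∣ ℚ.< ε)

  bound : ∀ x → ∃[ M ] 0ℚ ℚ.< M × Eventually (λ n → ∣ seq x n ∣ ℚ.≤ M)
  bound x with cauchy x 1ℚ (ℚ.positive⁻¹ 1ℚ)
  ... | N , c = ∣ seq x N ∣ + 1ℚ
    , ℚ.≤-<-trans (ℚ.0≤∣p∣ (seq x N))
        (subst (ℚ._< ∣ seq x N ∣ + 1ℚ) (ℚ.+-identityʳ _)
          (ℚ.+-monoʳ-< ∣ seq x N ∣ (ℚ.positive⁻¹ 1ℚ)))
    , N , λ n N≤n → ℚ.≤-trans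
        (subst (λ t → ∣ t ∣ ℚ.≤ ∣ seq x N ∣ + ∣ seq x n - seq x N ∣)
          (p≡q+[p-q] (seq x n) (seq x N))
          (ℚ.∣p+q∣≤∣p∣+∣q∣ (seq x N) (seq x n - seq x N)))
        (ℚ.+-monoʳ-≤ ∣ seq x N ∣ (ℚ.<⇒≤ (c n N N≤n ℕ.≤-refl)))

  bound₂ : ∀ x y → ∃[ M ] 0ℚ ℚ.< M ×
    Eventually (λ n → ∣ seq x n ∣ ℚ.≤ M × ∣ seq y n ∣ ℚ.≤ M)
  bound₂ x y = join (bound x) (bound y)
    where
    join : (∃[ M ] 0ℚ ℚ.< M × Eventually (λ n → ∣ seq x n ∣ ℚ.≤ M)) →
           (∃[ M ] 0ℚ ℚ.< M × Eventually (λ n → ∣ seq y n ∣ ℚ.≤ M)) →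
           ∃[ M ] 0ℚ ℚ.< M × Eventually (λ n → ∣ seq x n ∣ ℚ.≤ M × ∣ seq y n ∣ ℚ.≤ M)
    join (M , M>0 , K , p) (M′ , _ , K′ , q) =
      M ℚ.⊔ M′ , ℚ.<-≤-trans {0ℚ} {M} M>0 l , K ℕ.⊔ K′ , λ n le →
        ℚ.≤-trans {∣ seq x n ∣} {M} (p n (ℕ.≤-trans (ℕ.m≤m⊔n K K′) le)) l ,
        ℚ.≤-trans {∣ seq y n ∣} {M′} (q n (ℕ.≤-trans (ℕ.m≤n⊔m K K′) le)) r
      where
      l : M ℚ.≤ M ℚ.⊔ M′
      l = ℚ.p≤p⊔q M M′
      r : M′ ℚ.≤ M ℚ.⊔ M′
      r = ℚ.p≤q⊔p M M′

  lift₂ : ∀ f → LocallyUC f → ℝ → ℝ → ℝ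
  lift₂ f uc x y = mkℝ (λ n → f (seq x n) (seq y n)) λ ε ε>0 →
    let M , M>0 , K , b = bound₂ x y
        δ , δ>0 , near  = uc M M>0 ε ε>0
        N₁ , c₁         = cauchy x δ δ>0
        N₂ , c₂         = cauchy y δ δ>0
        N               = K ℕ.⊔ (N₁ ℕ.⊔ N₂)
        K≤N             = ℕ.m≤m⊔n K (N₁ ℕ.⊔ N₂)
        N₁≤N            = ℕ.≤-trans (ℕ.m≤m⊔n N₁ N₂) (ℕ.m≤n⊔m K (N₁ ℕ.⊔ N₂))
        N₂≤N            = ℕ.≤-trans (ℕ.m≤n⊔m N₁ N₂) (ℕ.m≤n⊔m K (N₁ ℕ.⊔ N₂))
    in N , λ m n N≤m N≤n → near _ _ _ _
      (proj₁ (b m (ℕ.≤-trans K≤N N≤m)))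
      (proj₂ (b n (ℕ.≤-trans K≤N N≤n)))
      (c₁ m n (ℕ.≤-trans N₁≤N N≤m) (ℕ.≤-trans N₁≤N N≤n))
      (c₂ m n (ℕ.≤-trans N₂≤N N≤m) (ℕ.≤-trans N₂≤N N≤n))

  lift₂-cong : ∀ f (uc : LocallyUC f) {x x′ y y′} → x ≈ℝ x′ → y ≈ℝ y′ →
               lift₂ f uc x y ≈ℝ lift₂ f uc x′ y′
  lift₂-cong f uc {x} {x′} {y} {y′} p q ε ε>0 =
    let M , M>0 , b    = bound₂ x y′
        δ , δ>0 , near = uc M M>0 ε ε>0
    in both b (both (p δ δ>0) (q δ δ>0) (λ _ → _,_))
         (λ n (bx , by) (px , qy) → near _ _ _ _ bx by px qy)

  +-uc : LocallyUC _+_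
  +-uc M M>0 ε ε>0 = ½ * ε , half>0 ε>0 , λ p q p′ q′ _ _ l r →
    ℚ.≤-<-trans
      (subst (λ t → ∣ t ∣ ℚ.≤ ∣ p - p′ ∣ + ∣ q - q′ ∣) (eq p q p′ q′)
        (ℚ.∣p+q∣≤∣p∣+∣q∣ (p - p′) (q - q′)))
      (subst (∣ p - p′ ∣ + ∣ q - q′ ∣ ℚ.<_) (halves ε) (ℚ.+-mono-< l r))
    where
    open +-*-Solver
    eq : ∀ p q p′ q′ → (p - p′) + (q - q′) ≡ (p + q) - (p′ + q′)
    eq = solve 4 (λ p q p′ q′ → (p :- p′) :+ (q :- q′) := (p :+ q) :- (p′ :+ q′)) refl

  *-uc : LocallyUC _*_
  *-uc M M>0 ε ε>0 = δ , δ>0 , λ p q p′ q′ bp bq′ l r →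
    ℚ.≤-<-trans
      (subst (λ t → ∣ t ∣ ℚ.≤ ∣ p * (q - q′) ∣ + ∣ q′ * (p - p′) ∣) (eq p q p′ q′)
        (ℚ.∣p+q∣≤∣p∣+∣q∣ (p * (q - q′)) (q′ * (p - p′))))
      (subst (∣ p * (q - q′) ∣ + ∣ q′ * (p - p′) ∣ ℚ.<_) (halves ε)
        (ℚ.+-mono-< (small p (q - q′) bp r) (small q′ (p - p′) bq′ l)))
    where
    instance
      M-pos : ℚ.Positive M
      M-pos = ℚ.positive M>0
      M-nonZero : ℚ.NonZero M
      M-nonZero = ℚ.pos⇒nonZero M
      1/M-pos : ℚ.Positive (ℚ.1/ M)
      1/M-pos = ℚ.1/pos⇒pos M
    δ : ℚ
    δ = (ℚ.1/ M) * (½ * ε)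
    δ>0 : 0ℚ ℚ.< δ
    δ>0 = subst (ℚ._< δ) (ℚ.*-zeroʳ (ℚ.1/ M)) (ℚ.*-monoʳ-<-pos (ℚ.1/ M) (half>0 ε>0))
    Mδ≡ε/2 : M * δ ≡ ½ * ε
    Mδ≡ε/2 = trans (sym (ℚ.*-assoc M (ℚ.1/ M) (½ * ε)))
      (trans (cong (_* (½ * ε)) (ℚ.*-inverseʳ M)) (ℚ.*-identityˡ (½ * ε)))
    small : ∀ s t → ∣ s ∣ ℚ.≤ M → ∣ t ∣ ℚ.< δ → ∣ s * t ∣ ℚ.< ½ * ε
    small s t bs lt = subst (ℚ._< ½ * ε) (sym (ℚ.∣p*q∣≡∣p∣*∣q∣ s t))
      (ℚ.≤-<-trans (ℚ.*-monoʳ-≤-nonNeg ∣ t ∣ {{ℚ.∣-∣-nonNeg t}} bs)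
        (subst (M * ∣ t ∣ ℚ.<_) Mδ≡ε/2 (ℚ.*-monoʳ-<-pos M lt)))
    open +-*-Solver
    eq : ∀ p q p′ q′ → p * (q - q′) + q′ * (p - p′) ≡ p * q - p′ * q′
    eq = solve 4 (λ p q p′ q′ →
      p :* (q :- q′) :+ q′ :* (p :- p′) := p :* q :- p′ :* q′) refl

  neg-lip : Lipschitz (λ p → - p)
  neg-lip p q = ℚ.≤-reflexive (trans (cong ∣_∣ (eq p q)) (∣p-q∣≡∣q-p∣ q p))
    where
    open +-*-Solver
    eq : ∀ p q → - p - - q ≡ q - p
    eq = solve 2 (λ p q → :- p :- :- q := q :- p) refl

  ∣p∣-∣q∣≤∣p-q∣ : ∀ p q → ∣ p ∣ - ∣ q ∣ ℚ.≤ ∣ p - q ∣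
  ∣p∣-∣q∣≤∣p-q∣ p q = subst (∣ p ∣ - ∣ q ∣ ℚ.≤_) (cancel ∣ q ∣ ∣ p - q ∣)
    (ℚ.+-monoˡ-≤ (- ∣ q ∣)
      (subst (λ t → ∣ t ∣ ℚ.≤ ∣ q ∣ + ∣ p - q ∣) (p≡q+[p-q] p q)
        (ℚ.∣p+q∣≤∣p∣+∣q∣ q (p - q))))
    where
    open +-*-Solver
    cancel : ∀ s t → (s + t) - s ≡ t
    cancel = solve 2 (λ s t → (s :+ t) :- s := t) refl

  ∣∣-lip : Lipschitz ∣_∣
  ∣∣-lip p q with ℚ.∣p∣≡p∨∣p∣≡-p (∣ p ∣ - ∣ q ∣)
  ... | inj₁ eq = subst (ℚ._≤ ∣ p - q ∣) (sym eq) (∣p∣-∣q∣≤∣p-q∣ p q)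
  ... | inj₂ eq = subst (ℚ._≤ ∣ p - q ∣) (sym (trans eq (-[p-q]≡q-p ∣ p ∣ ∣ q ∣)))
                    (subst (∣ q ∣ - ∣ p ∣ ℚ.≤_) (∣p-q∣≡∣q-p∣ q p) (∣p∣-∣q∣≤∣p-q∣ q p))

  constant : ℚ → ℝ
  constant q = mkℝ (λ _ → q) λ ε ε>0 → 0 , λ _ _ _ _ →
    subst (ℚ._< ε) (sym (∣p-p∣≡0 q)) ε>0

infixl 6 _+ℝ_ _-ℝ_
infixl 7 _*ℝ_
infix  8 -ℝ_

-- Opaque, since normalising rational arithmetic on open terms is very slow.
opaque
  0ℝ 1ℝ : ℝ
  0ℝ = constant 0ℚ
  1ℝ = constant 1ℚ

  -ℝ_ ∣_∣ℝ : ℝ → ℝ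
  -ℝ_ = lift₁ (λ p → - p) neg-lip
  ∣_∣ℝ = lift₁ ∣_∣ ∣∣-lip

  _+ℝ_ _*ℝ_ _-ℝ_ : ℝ → ℝ → ℝ
  _+ℝ_ = lift₂ _+_ +-uc
  _*ℝ_ = lift₂ _*_ *-uc
  x -ℝ y = x +ℝ (-ℝ y)

opaque
  unfolding 0ℝ

  ℝ-isCommutativeRing : IsCommutativeRing _≈ℝ_ _+ℝ_ _*ℝ_ -ℝ_ 0ℝ 1ℝ
  ℝ-isCommutativeRing = record
    { isRing = record
      { +-isAbelianGroup = record
        { isGroup = record
          { isMonoid = record
            { isSemigroup = record
              { isMagma = record
                { isEquivalence = ≈ℝ-isEquivalence
                ; ∙-cong = λ {x} {x′} {y} {y′} → lift₂-cong _+_ +-uc {x} {x′} {y} {y′}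
                }
              ; assoc = λ x y z → ≡⇒≈ {(x +ℝ y) +ℝ z} {x +ℝ (y +ℝ z)}
                  λ n → ℚ.+-assoc (seq x n) (seq y n) (seq z n)
              }
            ; identity = (λ x → ≡⇒≈ {0ℝ +ℝ x} {x} λ n → ℚ.+-identityˡ (seq x n))
                       , (λ x → ≡⇒≈ {x +ℝ 0ℝ} {x} λ n → ℚ.+-identityʳ (seq x n))
            }
          ; inverse = (λ x → ≡⇒≈ { -ℝ x +ℝ x} {0ℝ} λ n → ℚ.+-inverseˡ (seq x n))
                    , (λ x → ≡⇒≈ {x +ℝ -ℝ x} {0ℝ} λ n → ℚ.+-inverseʳ (seq x n))
          ; ⁻¹-cong = λ {x} {y} → lift₁-cong (λ p → - p) neg-lip {x} {y}
          }
        ; comm = λ x y → ≡⇒≈ {x +ℝ y} {y +ℝ x} λ n → ℚ.+-comm (seq x n) (seq y n)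
        }
      ; *-cong = λ {x} {x′} {y} {y′} → lift₂-cong _*_ *-uc {x} {x′} {y} {y′}
      ; *-assoc = λ x y z → ≡⇒≈ {(x *ℝ y) *ℝ z} {x *ℝ (y *ℝ z)}
          λ n → ℚ.*-assoc (seq x n) (seq y n) (seq z n)
      ; *-identity = (λ x → ≡⇒≈ {1ℝ *ℝ x} {x} λ n → ℚ.*-identityˡ (seq x n))
                   , (λ x → ≡⇒≈ {x *ℝ 1ℝ} {x} λ n → ℚ.*-identityʳ (seq x n))
      ; distrib = (λ x y z → ≡⇒≈ {x *ℝ (y +ℝ z)} {x *ℝ y +ℝ x *ℝ z}
                    λ n → ℚ.*-distribˡ-+ (seq x n) (seq y n) (seq z n))
                , (λ x y z → ≡⇒≈ {(y +ℝ z) *ℝ x} {y *ℝ x +ℝ z *ℝ x}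
                    λ n → ℚ.*-distribʳ-+ (seq x n) (seq y n) (seq z n))
      }
    ; *-comm = λ x y → ≡⇒≈ {x *ℝ y} {y *ℝ x} λ n → ℚ.*-comm (seq x n) (seq y n)
    }

ℝ-commutativeRing : CommutativeRing 0ℓ 0ℓ
ℝ-commutativeRing = record { isCommutativeRing = ℝ-isCommutativeRing }

VectorSpace : ∀ m ℓ → Set (Level.suc (m ⊔ ℓ))
VectorSpace = LeftModule (CommutativeRing.ring ℝ-commutativeRing)

module _ {m ℓ} (X : VectorSpace m ℓ) where
  open LeftModule X

  -- Pseudometrics are required to separate points here, which makes them
  -- metrics.
  IsPseudometric : DistanceFunction Carrierᴹ ℝ → Set (m ⊔ ℓ)
  IsPseudometric = IsGeneralMetric _≈ᴹ_ _≈ℝ_ _≤ℝ_ 0ℝ _+ℝ_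

  module _ (d : DistanceFunction Carrierᴹ ℝ) where

    +-Continuous : Set m
    +-Continuous = ∀ a b ε → 0ℝ <ℝ ε → ∃[ δ ] 0ℝ <ℝ δ ×
      (∀ a′ b′ → d a′ a <ℝ δ → d b′ b <ℝ δ → d (a′ +ᴹ b′) (a +ᴹ b) <ℝ ε)

    *ₗ-Continuous : Set m
    *ₗ-Continuous = ∀ α a ε → 0ℝ <ℝ ε → ∃[ δ ] 0ℝ <ℝ δ ×
      (∀ α′ a′ → ∣ α′ -ℝ α ∣ℝ <ℝ δ → d a′ a <ℝ δ → d (α′ *ₗ a′) (α *ₗ a) <ℝ ε)

    IsOpen : Pred Carrierᴹ 0ℓ → Set m
    IsOpen U = ∀ x → U x → ∃[ ε ] 0ℝ <ℝ ε × (∀ y → d y x <ℝ ε → U y)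

  -- Subsets at level 0ℓ suffice: balls live there, whatever m and ℓ are.
  SameTopology : (d d′ : DistanceFunction Carrierᴹ ℝ) → Set (Level.suc 0ℓ ⊔ m)
  SameTopology d d′ = ∀ U → IsOpen d U ⇔ IsOpen d′ U

  paranormDistance : (Carrierᴹ → ℝ) → DistanceFunction Carrierᴹ ℝ
  paranormDistance p a b = p (a +ᴹ -ᴹ b)

  record IsParanorm (p : Carrierᴹ → ℝ) : Set (m ⊔ ℓ) where
    field
      p-cong        : ∀ {x y} → x ≈ᴹ y → p x ≈ℝ p y
      p-zero        : p 0ᴹ ≈ℝ 0ℝ
      p-nonNegative : ∀ x → 0ℝ ≤ℝ p x
      p-neg         : ∀ x → p (-ᴹ x) ≈ℝ p x
      p-subadditive : ∀ x y → p (x +ᴹ y) ≤ℝ p x +ℝ p y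
      p-continuous  : *ₗ-Continuous (paranormDistance p)

  EquivalentToParanorm : DistanceFunction Carrierᴹ ℝ → Set (Level.suc 0ℓ ⊔ m ⊔ ℓ)
  EquivalentToParanorm σ = ∃[ p ] IsParanorm p × SameTopology σ (paranormDistance p)

  -- The topology is not a separate datum: it is the one determined by σ.
  record IsTopologicalVectorSpace (σ : DistanceFunction Carrierᴹ ℝ) : Set (m ⊔ ℓ) where
    field
      isPseudometric : IsPseudometric σ
      +-continuous   : +-Continuous σ
      *ₗ-continuous  : *ₗ-Continuous σ

module Ball {m ℓ} (X : VectorSpace m ℓ)
            (σ : DistanceFunction (LeftModule.Carrierᴹ X) ℝ)
            (c₀ : LeftModule.Carrierᴹ X) (r : ℝ) where

  open LeftModule X

  InBall : Carrierᴹ → Set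
  InBall x = σ x c₀ ≤ℝ r

  B : Set m
  B = Σ Carrierᴹ InBall

  infix 4 _≈ᴮ_
  _≈ᴮ_ : B → B → Set ℓ
  a ≈ᴮ b = proj₁ a ≈ᴹ proj₁ b

  -- A possibly undefined element of B; membership in the ball is not
  -- decidable, so Maybe B would not do.
  record Term : Set (Level.suc 0ℓ ⊔ m) where
    field
      Defined : Set
      value   : Defined → B

  open Term public

  vector : Carrierᴹ → Term
  vector x = record { Defined = InBall x ; value = x ,_ }

  -- Strict application: the arguments must be defined as well.
  apply₁ : (B → Term) → Term → Term
  apply₁ f s = record
    { Defined = Σ[ p ∈ Defined s ] Defined (f (value s p))
    ; value   = λ (p , q) → value (f (value s p)) q
    }

  apply₂ : (B → B → Term) → Term → Term → Term
  apply₂ f s t = record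
    { Defined = Σ[ p ∈ Defined s ] Σ[ q ∈ Defined t ] Defined (f (value s p) (value t q))
    ; value   = λ (p , q , w) → value (f (value s p) (value t q)) w
    }

  infix 6 _·_⊕_·_
  _·_⊕_·_ : ℝ → Term → ℝ → Term → Term
  α · s ⊕ β · t = apply₂ (λ a b → vector (α *ₗ proj₁ a +ᴹ β *ₗ proj₁ b)) s t

  infixl 6 _⊕_
  _⊕_ : Term → Term → Term
  s ⊕ t = 1ℝ · s ⊕ 1ℝ · t

  infixr 7 _∙_
  _∙_ : ℝ → Term → Term
  α ∙ s = apply₁ (λ a → vector (α *ₗ proj₁ a)) s

  infix 8 `_
  `_ : B → Term
  ` a = record { Defined = ⊤ ; value = λ _ → a }

  `0 : Term
  `0 = vector 0ᴹ

  infix 4 _≈ω_ _≈ˢ_ _≈ᵉ_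

  _≈ω_ : Term → Term → Set ℓ
  s ≈ω t = (p : Defined s) (q : Defined t) → value s p ≈ᴮ value t q

  _≈ˢ_ : Term → Term → Set ℓ
  s ≈ˢ t = (Defined s ⇔ Defined t) × s ≈ω t

  _≈ᵉ_ : Term → Term → Set ℓ
  s ≈ᵉ t = Defined s × Defined t × s ≈ω t

{-# OPTIONS --safe #-}
module Submission where

open import Defs
open import Algebra.Bundles using (AbelianGroup)
open import Algebra.Module.Bundles using (LeftModule)
import Algebra.Properties.Group as GroupProperties
open import Data.Product.Base using (_×_; _,_)
open import Function.Bundles using (mk⇔)
open import Function.Metric.Core using (DistanceFunction)
open import Function.Metric.Structures using (IsGeneralMetric)
open import Relation.Binary.Structures using (IsPartialOrder)
import Relation.Binary.Reasoning.Setoid as SetoidReasoning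

-- A defined term takes the value computed in `X`, so each equality of values is an identity of `X`:
-- commutativity, associativity, the scalar laws. For `≈ˢ` definedness must transfer too: both sides
-- have the same defined arguments and `≈ᴹ`-equal results, and the ball respects `≈ᴹ`. The last
-- clause is cancellation in the additive group.

module _ {m ℓ} (X : VectorSpace m ℓ) where

  open LeftModule X
  open SetoidReasoning ≈ᴹ-setoid
  open GroupProperties (AbelianGroup.group +ᴹ-abelianGroup)
    using () renaming (∙-cancelˡ to +ᴹ-cancelˡ)

  unit-combination : ∀ x y → 1ℝ *ₗ x +ᴹ 1ℝ *ₗ y ≈ᴹ x +ᴹ y
  unit-combination x y = +ᴹ-cong (*ₗ-identityˡ x) (*ₗ-identityˡ y)

  -- Nested `⊕` puts coefficients `1ℝ` on the inner sums; the unit law strips them, leaving plain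
  -- associativity.
  unit-combination-assoc : ∀ x y z →
    1ℝ *ₗ x +ᴹ 1ℝ *ₗ (1ℝ *ₗ y +ᴹ 1ℝ *ₗ z) ≈ᴹ 1ℝ *ₗ (1ℝ *ₗ x +ᴹ 1ℝ *ₗ y) +ᴹ 1ℝ *ₗ z
  unit-combination-assoc x y z = begin
    1ℝ *ₗ x +ᴹ 1ℝ *ₗ (1ℝ *ₗ y +ᴹ 1ℝ *ₗ z)  ≈⟨ unit-combination x _ ⟩
    x +ᴹ (1ℝ *ₗ y +ᴹ 1ℝ *ₗ z)              ≈⟨ +ᴹ-congˡ (unit-combination y z) ⟩
    x +ᴹ (y +ᴹ z)                          ≈⟨ +ᴹ-assoc x y z ⟨
    (x +ᴹ y) +ᴹ z                          ≈⟨ +ᴹ-congʳ (unit-combination x y) ⟨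
    (1ℝ *ₗ x +ᴹ 1ℝ *ₗ y) +ᴹ z              ≈⟨ unit-combination _ z ⟨
    1ℝ *ₗ (1ℝ *ₗ x +ᴹ 1ℝ *ₗ y) +ᴹ 1ℝ *ₗ z  ∎

  unit-combination-cancelˡ : ∀ x y z →
    1ℝ *ₗ x +ᴹ 1ℝ *ₗ y ≈ᴹ 1ℝ *ₗ x +ᴹ 1ℝ *ₗ z → y ≈ᴹ z
  unit-combination-cancelˡ x y z eq = begin
    y        ≈⟨ *ₗ-identityˡ y ⟨
    1ℝ *ₗ y  ≈⟨ +ᴹ-cancelˡ (1ℝ *ₗ x) (1ℝ *ₗ y) (1ℝ *ₗ z) eq ⟩
    1ℝ *ₗ z  ≈⟨ *ₗ-identityˡ z ⟩
    z        ∎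

  -- `σ` is a congruence for `≈ᴹ`, so equal vectors are equally far from `c₀`. This carries
  -- definedness across `≈ˢ`.
  InBall-resp : ∀ {σ} → IsPseudometric X σ → ∀ c₀ r {x y} → x ≈ᴹ y →
                Ball.InBall X σ c₀ r x → Ball.InBall X σ c₀ r y
  InBall-resp {σ} metric c₀ r {x} {y} x≈y =
    IsPartialOrder.≤-respˡ-≈ ≤ℝ-isPartialOrder {r} {σ x c₀} {σ y c₀}
      (IsGeneralMetric.cong metric x≈y ≈ᴹ-refl)

theorem3 : ∀ {m ℓ} (X : VectorSpace m ℓ) (let open LeftModule X)
    (σ : DistanceFunction Carrierᴹ ℝ) →
    IsTopologicalVectorSpace X σ →
    EquivalentToParanorm X σ →
    (c₀ : Carrierᴹ) (r : ℝ) → 0ℝ <ℝ r →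
    let open Ball X σ c₀ r in
    (a b d : B) (α β : ℝ) →
    (` a ⊕ ` b ≈ˢ ` b ⊕ ` a)
    × (` a ⊕ (` b ⊕ ` d) ≈ω (` a ⊕ ` b) ⊕ ` d)
    × (α ∙ (β ∙ ` a) ≈ω (α *ℝ β) ∙ ` a)
    × (α · ` a ⊕ β · ` a ≈ˢ (α +ℝ β) ∙ ` a)
    × (` a ⊕ `0 ≈ˢ `0 ⊕ ` a)
    × ((` a ⊕ ` b ≈ᵉ `0) × (`0 ≈ᵉ ` a ⊕ ` d) → b ≈ᴮ d)
theorem3 X σ tvs _ c₀ r _ (a , _) (b , _) (d , _) α β =
    ( mk⇔ (λ (p , q , w) → q , p , resp (comm a b) w)
          (λ (q , p , w) → p , q , resp (comm b a) w)
    , λ _ _ → comm a b)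
  -- The two sides pass through different intermediate sums, each with its own ball condition; `≈ω`
  -- compares values only.
  , (λ _ _ → unit-combination-assoc X a b d)
  , (λ _ _ → ≈ᴹ-sym (*ₗ-assoc α β a))
  -- Both sides amount to a single ball condition, on vectors equal by distributivity.
  , ( mk⇔ (λ (p , _ , w) → p , resp (≈ᴹ-sym distrib) w)
          (λ (p , w) → p , p , resp distrib w)
    , λ _ _ → ≈ᴹ-sym distrib)
  -- Here `q` is the membership of `0ᴹ` in the ball, demanded by both sides.
  , ( mk⇔ (λ (p , q , w) → q , p , resp (comm a 0ᴹ) w)
          (λ (q , p , w) → p , q , resp (comm 0ᴹ a) w)
    , λ _ _ → comm a 0ᴹ)
  -- `p₀` and `q₀` may be different proofs that `0ᴹ` is in the ball, but the underlying vector is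
  -- `0ᴹ` for both, so the equations chain.
  , λ ((p , p₀ , a⊕b≈0) , (q₀ , q , 0≈a⊕d)) →
      unit-combination-cancelˡ X a b d (≈ᴹ-trans (a⊕b≈0 p p₀) (0≈a⊕d q₀ q))
  where
  open LeftModule X
  resp : ∀ {x y} → x ≈ᴹ y → Ball.InBall X σ c₀ r x → Ball.InBall X σ c₀ r y
  resp = InBall-resp X (IsTopologicalVectorSpace.isPseudometric tvs) c₀ r
  comm : ∀ x y → 1ℝ *ₗ x +ᴹ 1ℝ *ₗ y ≈ᴹ 1ℝ *ₗ y +ᴹ 1ℝ *ₗ x
  comm x y = +ᴹ-comm (1ℝ *ₗ x) (1ℝ *ₗ y)
  distrib : (α +ℝ β) *ₗ a ≈ᴹ α *ₗ a +ᴹ β *ₗ a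
  distrib = *ₗ-distribʳ a α β
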